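{- Let $D_0$ be a northeast diagram. Then the Kohnert polynomial $\mathfrak{K}_{D_0}$ is monomial multiplicity-free (all its coefficients in the monomial basis are $0$ or $1$) if and only if $D_0$ does not contain cells $x_1=(r_1,c_1)$ and $x_2=(r_2,c_2)$ such that: (a) $r_1<r_2$; (b) $c_1<c_2$; (c) there is at least one empty position $(r,c_1)$ (i.e. $(r,c_1)\notin D_0$) with $r<r_1$; and (d) for each column index $c>c_1$, there are at least two empty positions $(r,c)$ with $r\le r_1$.
   Context: A diagram is a finite subset of $\mathbb{N}\times\mathbb{N}$ ($\mathbb{N}=\{1,2,\dots\}$); an element $(r,c)$ is a cell in row $r$ and column $c$, rows numbered bottom to top; a position is empty if not in the diagram. A Kohnert move on $D$ selects a row, takes the rightmost cell $(r,c)$ of $D$ in that row, and moves it to $(r',c)$ where $r'$ is the largest $1\le r'<r$ with $(r',c)\notin D$ (no move if none exists). $\mathcal{P}(D)$ is the set of diagrams obtainable from $D$ by finitely many Kohnert moves (including $D$). The row weight $\mathrm{rwt}(T)$ of a diagram $T$ has $i$-th entry the number of cells of $T$ in row $i$. The Kohnert polynomial is $\mathfrak{K}_D=\sum_{T\in\mathcal{P}(D)}\prod_i x_i^{\mathrm{rwt}(T)_i}$. A diagram $D$ is northeast if for all cells $(r_1,c_1),(r_2,c_2)\in D$, $(\max(r_1,r_2),\max(c_1,c_2))\in D$. -}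

module Defs where

open import Data.Nat using (ℕ; _≤_; _<_; _⊔_; _≟_)
open import Data.Product using (_×_; _,_; proj₁; Σ; ∃; ∃-syntax)
open import Data.Product.Properties using (≡-dec)
open import Data.List using (List; _∷_; []; filter; length)
open import Data.List.Membership.Propositional using (_∈_; _∉_)
open import Data.List.Relation.Unary.Unique.Propositional using (Unique)
open import Relation.Binary.PropositionalEquality using (_≡_; _≢_)
open import Relation.Nullary using (¬_; Dec; ¬?)
open import Function.Bundles using (_⇔_)

-- A cell (r , c): row r, column c (rows numbered bottom to top, starting at 1).
Cell : Set
Cell = ℕ × ℕ

-- A diagram is a finite set of cells, represented by a duplicate-free list
-- (see WellFormed) whose order is irrelevant; diagrams are compared as sets.
Diagram : Set
Diagram = List Cell

_≟c_ : (x y : Cell) → Dec (x ≡ y)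
_≟c_ = Data.Product.Properties.≡-dec _≟_ _≟_

WellFormed : Diagram → Set
WellFormed D = Unique D × (∀ r c → (r , c) ∈ D → 1 ≤ r × 1 ≤ c)

_≈D_ : Diagram → Diagram → Set
T ≈D T′ = ∀ x → (x ∈ T) ⇔ (x ∈ T′)

removeCell : Cell → Diagram → Diagram
removeCell x D = filter (λ y → ¬? (y ≟c x)) D

moveCell : ℕ → ℕ → ℕ → Diagram → Diagram
moveCell r c r′ D = (r′ , c) ∷ removeCell (r , c) D

data KohnertMove (D : Diagram) : Diagram → Set where
  kmove : (r c r′ : ℕ) →
          (r , c) ∈ D →
          (∀ c′ → (r , c′) ∈ D → c′ ≤ c) →
          1 ≤ r′ → r′ < r →
          (r′ , c) ∉ D →
          (∀ s → r′ < s → s < r → (s , c) ∈ D) →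
          KohnertMove D (moveCell r c r′ D)

-- Reachable D T : T is obtained from D by finitely many Kohnert moves.
-- The set 𝒫(D) is { T | Reachable D T } (up to ≈D).
data Reachable (D : Diagram) : Diagram → Set where
  here : Reachable D D
  step : ∀ {E F} → Reachable D E → KohnertMove E F → Reachable D F

rowCount : Diagram → ℕ → ℕ
rowCount T i = length (filter (λ x → proj₁ x ≟ i) T)

Northeast : Diagram → Set
Northeast D = ∀ r₁ c₁ r₂ c₂ → (r₁ , c₁) ∈ D → (r₂ , c₂) ∈ D →
              (r₁ ⊔ r₂ , c₁ ⊔ c₂) ∈ D

-- 𝔎_D is monomial multiplicity-free: the coefficient of each monomial x^w,
-- i.e. the number of distinct diagrams T ∈ 𝒫(D) with rwt(T) = w, is at most 1:
-- any two diagrams of 𝒫(D) with the same row weight are the same diagram.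
MultiplicityFree : Diagram → Set
MultiplicityFree D = ∀ T T′ → Reachable D T → Reachable D T′ →
                     (∀ i → rowCount T i ≡ rowCount T′ i) → T ≈D T′

BadPair : Diagram → Set
BadPair D =
  Σ ℕ λ r₁ → Σ ℕ λ c₁ → Σ ℕ λ r₂ → Σ ℕ λ c₂ →
    (r₁ , c₁) ∈ D × (r₂ , c₂) ∈ D ×
    r₁ < r₂ × c₁ < c₂ ×
    (∃[ r ] (1 ≤ r × r < r₁ × (r , c₁) ∉ D)) ×
    (∀ c → c₁ < c →
       ∃[ r ] ∃[ r′ ] (r ≢ r′ × 1 ≤ r × r ≤ r₁ × 1 ≤ r′ × r′ ≤ r₁ ×
                       (r , c) ∉ D × (r′ , c) ∉ D))

{-# OPTIONS --safe #-}
module Submission where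

-- For a northeast diagram D the members of 𝒫(D) are the images of the height
-- functions h on the cells of D (h L c is the new row of the cell (L , c), and
-- L is called its label) with 1 ≤ h L c ≤ L that increase strictly up each
-- column and decrease weakly to the right along each row.
--
-- Given a bad pair, push the cells with labels ≤ r₁ in the columns right of c₁
-- below row r₁ − 1, and those of column c₁ below row r₁. Then x₁ and x₂ can be
-- placed in rows r₁ and r₁ − 1 in either order, giving two diagrams of equal weight.
--
-- Conversely, in the topmost row r where two diagrams of equal weight differ there
-- are columns c₁ < c₂ with (r , c₁) in the first only and (r , c₂) in the second
-- only. The labels L₁, L₂ of these cells satisfy L₁ < L₂, and (L₁ , c), (L₂ , c₂)
-- is a bad pair for c = c₁ or for some c between c₁ and c₂.

open import Defs
open import Data.Bool using (true; false; if_then_else_)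
open import Data.Empty using (⊥; ⊥-elim)
open import Data.List using (List; []; _∷_; _++_; filter; length; map)
open import Data.List.Membership.DecPropositional _≟c_ using (_∈?_)
open import Data.List.Membership.Propositional using (_∈_; _∉_; find)
open import Data.List.Membership.Propositional.Properties using (∈-∃++; ∈-filter⁺; ∈-filter⁻; ∈-map⁺; ∈-map⁻)
open import Data.List.Properties using (map-cong-local)
open import Data.List.Relation.Binary.Permutation.Propositional.Properties using (shift; ↭-length; ∈-resp-↭)
open import Data.List.Relation.Unary.All as All using ([]; _∷_)
open import Data.List.Relation.Unary.All.Properties using (¬Any⇒All¬) renaming (map⁺ to All-map⁺)
open import Data.List.Relation.Unary.AllPairs using ([]; _∷_)
open import Data.List.Relation.Unary.Any using (here; there; any?)
open import Data.List.Relation.Unary.Unique.Propositional using (Unique)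
open import Data.List.Relation.Unary.Unique.Propositional.Properties using () renaming (filter⁺ to Unique-filter⁺)
open import Data.Nat using (ℕ; zero; suc; pred; _+_; _∸_; _⊔_; _⊓_; _≤_; _<_; _≟_; _≤?_; _<?_; z≤n; s≤s; s≤s⁻¹)
open import Data.Nat.Properties
open import Data.Product using (∃-syntax; _×_; _,_; proj₁; proj₂)
open import Data.Product.Properties using (,-injectiveˡ; ,-injectiveʳ)
open import Data.Sum using (_⊎_; inj₁; inj₂)
open import Function.Bundles using (_⇔_; mk⇔; Equivalence)
open import Relation.Binary.Definitions using (Tri; tri<; tri≈; tri>)
open import Relation.Binary.PropositionalEquality using (_≡_; _≢_; refl; sym; trans; cong; cong₂; subst; subst₂; module ≡-Reasoning)
open import Relation.Nullary using (¬_; Dec; yes; no; does; ¬?; _×-dec_)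
open import Relation.Nullary.Decidable using (decidable-stable)

-- Lists without repetition, row counts and Kohnert moves

length-⊆ : {A : Set} {xs ys : List A} → Unique xs →
           (∀ {x} → x ∈ xs → x ∈ ys) → length xs ≤ length ys
length-⊆ {xs = []}              _        _     = z≤n
length-⊆ {xs = x ∷ xs} (x∉xs ∷ u) xs⊆ys with ∈-∃++ (xs⊆ys (here refl))
... | as , bs , refl =
  subst (suc (length xs) ≤_) (sym (↭-length (shift x as bs))) (s≤s (length-⊆ u xs⊆as++bs))
  where
  xs⊆as++bs : ∀ {y} → y ∈ xs → y ∈ as ++ bs
  xs⊆as++bs y∈xs with ∈-resp-↭ (shift x as bs) (xs⊆ys (there y∈xs))
  ... | here refl = ⊥-elim (All.lookup x∉xs y∈xs refl)
  ... | there p   = p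

Unique-map⁺ : {A B : Set} {f : A → B} {xs : List A} →
              (∀ {x y} → x ∈ xs → y ∈ xs → f x ≡ f y → x ≡ y) →
              Unique xs → Unique (map f xs)
Unique-map⁺ inj []          = []
Unique-map⁺ inj (x∉xs ∷ u) =
  All-map⁺ (All.tabulate λ y∈xs fx≡fy → All.lookup x∉xs y∈xs (inj (here refl) (there y∈xs) fx≡fy))
  ∷ Unique-map⁺ (λ p q → inj (there p) (there q)) u

rowCount-≤ : ∀ {S T} → Unique S → (∀ {x} → x ∈ S → x ∈ T) → ∀ i → rowCount S i ≤ rowCount T i
rowCount-≤ u S⊆T i = length-⊆ (Unique-filter⁺ _ u) λ x∈ →
  let x∈S , eq = ∈-filter⁻ (λ x → proj₁ x ≟ i) x∈ in ∈-filter⁺ (λ x → proj₁ x ≟ i) (S⊆T x∈S) eq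

rowCount-cong : ∀ {S T} → Unique S → Unique T → S ≈D T → ∀ i → rowCount S i ≡ rowCount T i
rowCount-cong u v S≈T i =
  ≤-antisym (rowCount-≤ u (λ {x} → Equivalence.to (S≈T x)) i)
            (rowCount-≤ v (λ {x} → Equivalence.from (S≈T x)) i)

rowCount-∷ : ∀ r c T i → rowCount ((r , c) ∷ T) i ≡ (if does (r ≟ i) then 1 else 0) + rowCount T i
rowCount-∷ r c T i with does (r ≟ i)
... | true  = refl
... | false = refl

-- Pigeonhole: if row `i` of `T′` were contained in `T`, then together with `(i , c)` it would be a
-- repetition-free list inside row `i` of `T`, one longer than the equal counts permit.
row-exchange : ∀ {T T′ i c} → Unique T′ → rowCount T i ≡ rowCount T′ i →
               (i , c) ∈ T → (i , c) ∉ T′ → ∃[ d ] ((i , d) ∈ T′ × (i , d) ∉ T)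
row-exchange {T} {T′} {i} {c} u′ eq x∈T x∉T′
  with any? (λ x → ¬? (x ∈? T)) (filter (λ x → proj₁ x ≟ i) T′)
... | yes p =
  let (j , d) , y∈ , y∉T = find p
      y∈T′ , j≡i         = ∈-filter⁻ (λ x → proj₁ x ≟ i) {xs = T′} y∈
  in d , subst (λ k → (k , d) ∈ T′) j≡i y∈T′ , subst (λ k → (k , d) ∉ T) j≡i y∉T
... | no ∄ = ⊥-elim (<-irrefl (sym eq) (length-⊆ unique included))
  where
  row′ = filter (λ x → proj₁ x ≟ i) T′
  unique : Unique ((i , c) ∷ row′)
  unique = All.tabulate (λ { y∈ refl → x∉T′ (proj₁ (∈-filter⁻ (λ x → proj₁ x ≟ i) y∈)) })
           ∷ Unique-filter⁺ _ u′
  included : ∀ {y} → y ∈ (i , c) ∷ row′ → y ∈ filter (λ x → proj₁ x ≟ i) T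
  included (here refl) = ∈-filter⁺ (λ x → proj₁ x ≟ i) x∈T refl
  included {y} (there y∈) =
    ∈-filter⁺ (λ x → proj₁ x ≟ i)
      (decidable-stable (y ∈? T) (All.lookup (¬Any⇒All¬ row′ ∄) y∈))
      (proj₂ (∈-filter⁻ (λ x → proj₁ x ≟ i) {xs = T′} y∈))

∈-moveCell⁻ : ∀ {r c r′ T x} → x ∈ moveCell r c r′ T → x ≡ (r′ , c) ⊎ (x ∈ T × x ≢ (r , c))
∈-moveCell⁻ (here eq) = inj₁ eq
∈-moveCell⁻ {r} {c} (there p) = inj₂ (∈-filter⁻ (λ y → ¬? (y ≟c (r , c))) p)

∈-moveCell⁺ : ∀ {r c r′ T x} → x ∈ T → x ≢ (r , c) → x ∈ moveCell r c r′ T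
∈-moveCell⁺ {r} {c} x∈T x≢ = there (∈-filter⁺ (λ y → ¬? (y ≟c (r , c))) x∈T x≢)

Reachable-Unique : ∀ {D T} → Unique D → Reachable D T → Unique T
Reachable-Unique u here = u
Reachable-Unique u (step D⟶E (kmove r c r′ _ _ _ _ x∉E _)) =
  All.tabulate (λ { y∈ refl → x∉E (proj₁ (∈-filter⁻ (λ y → ¬? (y ≟c (r , c))) y∈)) })
  ∷ Unique-filter⁺ _ (Reachable-Unique u D⟶E)

bound : (D : Diagram) → ∃[ N ] (∀ {r c} → (r , c) ∈ D → r ≤ N × c ≤ N)
bound [] = 0 , λ ()
bound ((r , c) ∷ D) with bound D
... | N , b = r ⊔ c ⊔ N , λ where
  (here refl) → ≤-trans (m≤m⊔n r c) (m≤m⊔n (r ⊔ c) N) , ≤-trans (m≤n⊔m r c) (m≤m⊔n (r ⊔ c) N)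
  (there p)   → let r≤ , c≤ = b p in ≤-trans r≤ (m≤n⊔m (r ⊔ c) N) , ≤-trans c≤ (m≤n⊔m (r ⊔ c) N)

-- Truncated subtraction and pointwise updates

m∸[n∸o]≤m+o∸n : ∀ m n o → m ∸ (n ∸ o) ≤ (m + o) ∸ n
m∸[n∸o]≤m+o∸n m n o = m≤n+o⇒m∸n≤o m (n ∸ o) (+-cancelʳ-≤ o m _ (begin
  m + o                         ≤⟨ m≤n+m∸n (m + o) n ⟩
  n + X                         ≤⟨ +-monoˡ-≤ X (m≤n+m∸n n o) ⟩
  (o + (n ∸ o)) + X             ≡⟨ +-assoc o (n ∸ o) X ⟩
  o + ((n ∸ o) + X)             ≡⟨ +-comm o _ ⟩
  (n ∸ o) + X + o               ∎))
  where
  open ≤-Reasoning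
  X = (m + o) ∸ n

m+[n∸o]≤p : ∀ {m n o p} → o ≤ n → n + m ≤ o + p → m + (n ∸ o) ≤ p
m+[n∸o]≤p {m} {n} {o} {p} o≤n le =
  subst (_≤ p) (+-∸-assoc m o≤n) (m≤n+o⇒m∸n≤o (m + n) o (subst (_≤ o + p) (+-comm n m) le))

_[_,_↦_] : (ℕ → ℕ → ℕ) → ℕ → ℕ → ℕ → ℕ → ℕ → ℕ
(h [ L , c ↦ v ]) M d = if does ((M , d) ≟c (L , c)) then v else h M d

update-eq : ∀ h L c v → (h [ L , c ↦ v ]) L c ≡ v
update-eq h L c v with (L , c) ≟c (L , c)
... | yes _  = refl
... | no neq = ⊥-elim (neq refl)

update-≢ : ∀ h {L c v M d} → (M , d) ≢ (L , c) → (h [ L , c ↦ v ]) M d ≡ h M d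
update-≢ h {L} {c} {v} {M} {d} neq with (M , d) ≟c (L , c)
... | yes eq = ⊥-elim (neq eq)
... | no _   = refl

-- Height functions on a northeast diagram

module Heights (D : Diagram) (ne : Northeast D) where

  northeast : ∀ {r₁ c₁ r₂ c₂} → (r₁ , c₁) ∈ D → (r₂ , c₂) ∈ D → r₁ ≤ r₂ → c₂ ≤ c₁ → (r₂ , c₁) ∈ D
  northeast x∈ y∈ r₁≤r₂ c₂≤c₁ =
    subst₂ (λ r c → (r , c) ∈ D) (m≤n⇒m⊔n≡n r₁≤r₂) (m≥n⇒m⊔n≡m c₂≤c₁) (ne _ _ _ _ x∈ y∈)

  -- Heights are total functions of label and column; only the values at cells of `D` matter, so
  -- every condition is guarded by membership.
  record Valid (h : ℕ → ℕ → ℕ) : Set where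
    field
      positive   : ∀ {L c} → (L , c) ∈ D → 1 ≤ h L c
      bounded    : ∀ {L c} → (L , c) ∈ D → h L c ≤ L
      increasing : ∀ {L M c} → (L , c) ∈ D → (M , c) ∈ D → L < M → h L c < h M c
      decreasing : ∀ {L c d} → (L , c) ∈ D → (L , d) ∈ D → c < d → h L d ≤ h L c

    injective : ∀ {L M c} → (L , c) ∈ D → (M , c) ∈ D → h L c ≡ h M c → L ≡ M
    injective {L} {M} x∈ y∈ eq with <-cmp L M
    ... | tri< L<M _ _ = ⊥-elim (<-irrefl eq (increasing x∈ y∈ L<M))
    ... | tri≈ _ L≡M _ = L≡M
    ... | tri> _ _ M<L = ⊥-elim (<-irrefl (sym eq) (increasing y∈ x∈ M<L))

    reflects-< : ∀ {L M c} → (L , c) ∈ D → (M , c) ∈ D → h L c < h M c → L < M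
    reflects-< {L} {M} x∈ y∈ lt with <-cmp L M
    ... | tri< L<M _ _  = L<M
    ... | tri≈ _ refl _ = ⊥-elim (<-irrefl refl lt)
    ... | tri> _ _ M<L  = ⊥-elim (<-asym lt (increasing y∈ x∈ M<L))

    decreasing-≤ : ∀ {L c d} → (L , c) ∈ D → (L , d) ∈ D → c ≤ d → h L d ≤ h L c
    decreasing-≤ {c = c} {d} x∈ y∈ c≤d with m≤n⇒m<n∨m≡n c≤d
    ... | inj₁ c<d  = decreasing x∈ y∈ c<d
    ... | inj₂ refl = ≤-refl

  open Valid

  record Represents (h : ℕ → ℕ → ℕ) (T : Diagram) : Set where
    field
      label : ∀ {r c} → (r , c) ∈ T → ∃[ L ] ((L , c) ∈ D × h L c ≡ r)
      image : ∀ {L c} → (L , c) ∈ D → (h L c , c) ∈ T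

    image-≡ : ∀ {L c r} → (L , c) ∈ D → h L c ≡ r → (r , c) ∈ T
    image-≡ x∈ refl = image x∈

  open Represents

  update-valid : ∀ {h L c v} → Valid h → 1 ≤ v → v ≤ L →
    (∀ {M} → M < L → (M , c) ∈ D → h M c < v) →
    (∀ {M} → L < M → (M , c) ∈ D → v < h M c) →
    (∀ {d} → d < c → (L , d) ∈ D → v ≤ h L d) →
    (∀ {d} → c < d → (L , d) ∈ D → h L d ≤ v) →
    Valid (h [ L , c ↦ v ])
  update-valid {h} {L} {c} {v} V 1≤v v≤L below above left right = record
    { positive = pos ; bounded = bnd ; increasing = inc ; decreasing = dec }
    where
    h′ = h [ L , c ↦ v ]
    pos : ∀ {M d} → (M , d) ∈ D → 1 ≤ h′ M d
    pos {M} {d} x∈ with (M , d) ≟c (L , c)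
    ... | yes _ = 1≤v
    ... | no  _ = positive V x∈
    bnd : ∀ {M d} → (M , d) ∈ D → h′ M d ≤ M
    bnd {M} {d} x∈ with (M , d) ≟c (L , c)
    ... | yes refl = v≤L
    ... | no  _    = bounded V x∈
    inc : ∀ {M N d} → (M , d) ∈ D → (N , d) ∈ D → M < N → h′ M d < h′ N d
    inc {M} {N} {d} x∈ y∈ M<N with (M , d) ≟c (L , c) | (N , d) ≟c (L , c)
    ... | yes refl | yes refl = ⊥-elim (<-irrefl refl M<N)
    ... | yes refl | no _     = above M<N y∈
    ... | no _     | yes refl = below M<N x∈
    ... | no _     | no _     = increasing V x∈ y∈ M<N
    dec : ∀ {M d e} → (M , d) ∈ D → (M , e) ∈ D → d < e → h′ M e ≤ h′ M d
    dec {M} {d} {e} x∈ y∈ d<e with (M , d) ≟c (L , c) | (M , e) ≟c (L , c)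
    ... | yes refl | yes refl = ⊥-elim (<-irrefl refl d<e)
    ... | yes refl | no _     = right d<e y∈
    ... | no _     | yes refl = left d<e x∈
    ... | no _     | no _     = decreasing V x∈ y∈ d<e

  -- Reachable diagrams and valid heights, in both directions

  -- In terms of heights, the move lowers by one every cell of column `c` in rows `r′ + 1` to `r`.
  -- The resulting set of positions is that of the move, and the order of the labels within the
  -- column is kept.
  move-heights : ∀ {h T T′} → Valid h → Represents h T → KohnertMove T T′ →
                 ∃[ h′ ] (Valid h′ × Represents h′ T′)
  move-heights {h} {T} V R (kmove r c r′ x∈T rightmost 1≤r′ r′<r hole filled) =
    h′ , record { positive = pos ; bounded = bnd ; increasing = inc ; decreasing = dec }
       , record { label = lab ; image = img }
    where
    Moved : ℕ → ℕ → Set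
    Moved L d = d ≡ c × r′ < h L d × h L d ≤ r
    moved? : ∀ L d → Dec (Moved L d)
    moved? L d = (d ≟ c) ×-dec ((r′ <? h L d) ×-dec (h L d ≤? r))
    drop : ∀ {L d} → Dec (Moved L d) → ℕ
    drop {L} {d} (yes _) = pred (h L d)
    drop {L} {d} (no _)  = h L d
    h′ : ℕ → ℕ → ℕ
    h′ L d = drop (moved? L d)

    h′-moved : ∀ {L d s} → Moved L d → h L d ≡ suc s → h′ L d ≡ s
    h′-moved {L} {d} m eq with moved? L d
    ... | yes _ = cong pred eq
    ... | no ¬m = ⊥-elim (¬m m)
    h′-fixed : ∀ {L d s} → ¬ Moved L d → h L d ≡ s → h′ L d ≡ s
    h′-fixed {L} {d} ¬m eq with moved? L d
    ... | yes m = ⊥-elim (¬m m)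
    ... | no _  = eq

    block : ∀ {s} → r′ < s → s ≤ r → (s , c) ∈ T
    block r′<s s≤r with m≤n⇒m<n∨m≡n s≤r
    ... | inj₁ s<r  = filled _ r′<s s<r
    ... | inj₂ refl = x∈T

    -- Two cells of one label at equal height s in columns c < d force, by the
    -- northeast property, the same at height s + 1, up to row r.
    climb : ∀ k {L d s} → k + s ≡ r → r′ < s → c < d → (L , c) ∈ D → (L , d) ∈ D →
            h L c ≡ s → h L d ≡ s → ⊥
    climb zero refl r′<s c<d x∈ y∈ _ eq = <⇒≱ c<d (rightmost _ (image-≡ R y∈ eq))
    climb (suc k) {L} {d} {s} k+s≡r r′<s c<d x∈ y∈ refl eq
      with label R (block (m<n⇒m<1+n r′<s) (subst (suc s ≤_) k+s≡r (s≤s (m≤n+m s k))))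
    ... | M , z∈ , hM≡1+s = climb k (trans (+-suc k s) k+s≡r) (m<n⇒m<1+n r′<s) c<d z∈ w∈ hM≡1+s
            (≤-antisym (subst (h M d ≤_) hM≡1+s (decreasing V z∈ w∈ c<d))
                       (subst (_< h M d) eq (increasing V y∈ w∈ L<M)))
      where
      L<M : L < M
      L<M = reflects-< V x∈ z∈ (subst (s <_) (sym hM≡1+s) ≤-refl)
      w∈ : (M , d) ∈ D
      w∈ = northeast y∈ z∈ (<⇒≤ L<M) (<⇒≤ c<d)

    pos : ∀ {L d} → (L , d) ∈ D → 1 ≤ h′ L d
    pos {L} {d} y∈ with moved? L d
    ... | yes (_ , r′<h , _) = ≤-trans 1≤r′ (pred-mono-≤ r′<h)
    ... | no _               = positive V y∈
    bnd : ∀ {L d} → (L , d) ∈ D → h′ L d ≤ L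
    bnd {L} {d} y∈ with moved? L d
    ... | yes _ = ≤-trans pred[n]≤n (bounded V y∈)
    ... | no _  = bounded V y∈
    inc : ∀ {L M d} → (L , d) ∈ D → (M , d) ∈ D → L < M → h′ L d < h′ M d
    inc {L} {M} {d} y∈ z∈ L<M with increasing V y∈ z∈ L<M | moved? L d | moved? M d
    ... | lt | yes (_ , r′<h , _) | yes _ = <-≤-trans (pred-< r′<h) (pred-mono-≤ lt)
      where
      pred-< : ∀ {m n} → m < n → pred n < n
      pred-< (s≤s _) = ≤-refl
    ... | lt | yes _ | no _ = ≤-<-trans pred[n]≤n lt
    -- Row `r′` is empty in column `c`, so an unmoved cell under a moved one lies strictly below
    -- `r′`, while the moved one drops to `r′` at the lowest.
    ... | lt | no ¬m | yes (refl , r′<h , h≤r) = pred-mono-≤ (≤-trans (s≤s hL<r′) r′<h)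
      where
      hL<r′ : h L d < r′
      hL<r′ with <-cmp (h L d) r′
      ... | tri< p _ _    = p
      ... | tri≈ _ refl _ = ⊥-elim (hole (image R y∈))
      ... | tri> _ _ p    = ⊥-elim (¬m (refl , p , <⇒≤ (<-≤-trans lt h≤r)))
    ... | lt | no _ | no _ = lt
    dec : ∀ {L d e} → (L , d) ∈ D → (L , e) ∈ D → d < e → h′ L e ≤ h′ L d
    dec {L} {d} {e} y∈ z∈ d<e with decreasing V y∈ z∈ d<e | moved? L d | moved? L e
    ... | le | yes _ | yes _ = pred-mono-≤ le
    ... | le | no _  | yes _ = ≤-trans pred[n]≤n le
    ... | le | no _  | no _  = le
    -- Lowering the left cell alone breaks the weak decrease only when both heights are equal;
    -- `climb` rules this out.
    ... | le | yes (refl , r′<h , h≤r) | no _ with m≤n⇒m<n∨m≡n le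
    ... | inj₁ lt = pred-mono-≤ lt
    ... | inj₂ eq = ⊥-elim (climb (r ∸ h L d) (m∸n+n≡m h≤r) r′<h d<e y∈ z∈ refl eq)

    lab : ∀ {s d} → (s , d) ∈ moveCell r c r′ T → ∃[ L ] ((L , d) ∈ D × h′ L d ≡ s)
    lab p with ∈-moveCell⁻ {r} {c} {r′} {T} p
    -- The new cell in row `r′` carries the label of the cell formerly in row `r′ + 1`.
    ... | inj₁ refl with label R (block ≤-refl r′<r)
    ... | L , y∈ , eq = L , y∈ , h′-moved (refl , ≤-reflexive (sym eq) , ≤-trans (≤-reflexive eq) r′<r) eq
    lab {s} {d} p | inj₂ (q , neq) with (d ≟ c) ×-dec ((r′ <? s) ×-dec (s ≤? r))
    ... | no ¬m = let L , y∈ , eq = label R q in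
                  L , y∈ , h′-fixed (λ (a , b , e) → ¬m (a , subst (r′ <_) eq b , subst (_≤ r) eq e)) eq
    ... | yes (refl , r′<s , s≤r) with label R (block (m<n⇒m<1+n r′<s) (≤∧≢⇒< s≤r (λ { refl → neq refl })))
    ... | L , y∈ , eq = L , y∈ , h′-moved (refl , subst (r′ <_) (sym eq) (m<n⇒m<1+n r′<s)
                                              , subst (_≤ r) (sym eq) (≤∧≢⇒< s≤r (λ { refl → neq refl }))) eq

    img : ∀ {L d} → (L , d) ∈ D → (h′ L d , d) ∈ moveCell r c r′ T
    img {L} {d} y∈ with moved? L d
    ... | no ¬m = ∈-moveCell⁺ (image R y∈) λ eq →
                    ¬m (,-injectiveʳ eq , subst (r′ <_) (sym (,-injectiveˡ eq)) r′<r , ≤-reflexive (,-injectiveˡ eq))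
    ... | yes (refl , r′<h , h≤r) = dropped (h L d) r′<h h≤r
      where
      dropped : ∀ s → r′ < s → s ≤ r → (pred s , c) ∈ moveCell r c r′ T
      dropped (suc s) r′≤s s<r with m≤n⇒m<n∨m≡n (s≤s⁻¹ r′≤s)
      ... | inj₁ r′<s = ∈-moveCell⁺ (filled s r′<s s<r) (λ { refl → <-irrefl refl s<r })
      ... | inj₂ refl = here refl

  heights : ∀ {T} → (∀ {L c} → (L , c) ∈ D → 1 ≤ L) → Reachable D T → ∃[ h ] (Valid h × Represents h T)
  heights 1≤ here = (λ L _ → L)
    , record { positive = 1≤ ; bounded = λ _ → ≤-refl ; increasing = λ _ _ L<M → L<M ; decreasing = λ _ _ _ → ≤-refl }
    , record { label = λ x∈ → _ , x∈ , refl ; image = λ x∈ → x∈ }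
  heights 1≤ (step D⟶E move) with heights 1≤ D⟶E
  ... | h , V , R = move-heights V R move

  -- The last move of a sequence realising h lowers the leftmost cell of the
  -- highest label that h does not fix.
  raise : ∀ {h L c} → Valid h → (L , c) ∈ D → h L c < L →
          (∀ {M d} → L < M → (M , d) ∈ D → h M d ≡ M) →
          (∀ {d} → d < c → (L , d) ∈ D → h L d ≡ L) →
          let h⁺ = h [ L , c ↦ suc (h L c) ] in
          Valid h⁺ ×
          (∀ {T} → Represents h⁺ T → ∃[ T′ ] (KohnertMove T T′ × Represents h T′))
  raise {h} {L} {c} V x∈ h<L above left = V⁺ , lower
    where
    s  = suc (h L c)
    h⁺ = h [ L , c ↦ s ]
    V⁺ : Valid h⁺
    V⁺ = update-valid V (s≤s z≤n) h<L
      (λ M<L y∈ → m<n⇒m<1+n (increasing V y∈ x∈ M<L))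
      (λ L<M y∈ → subst (s <_) (sym (above L<M y∈)) (≤-<-trans h<L L<M))
      (λ d<c y∈ → subst (s ≤_) (sym (left d<c y∈)) h<L)
      (λ c<d y∈ → m≤n⇒m≤1+n (decreasing V x∈ y∈ c<d))
    lower : ∀ {T} → Represents h⁺ T → ∃[ T′ ] (KohnertMove T T′ × Represents h T′)
    lower {T} R = moveCell s c (h L c) T
      , kmove s c (h L c) (image-≡ R x∈ (update-eq h L c s)) rightmost (positive V x∈) ≤-refl hole
          (λ t p q → ⊥-elim (<-irrefl refl (<-≤-trans p (s≤s⁻¹ q))))
      , record { label = lab ; image = img }
      where
      labels : ∀ {t d} → (t , d) ∈ T → (t ≡ s × d ≡ c) ⊎ ∃[ M ] ((M , d) ∈ D × (M , d) ≢ (L , c) × h M d ≡ t)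
      labels {t} {d} p with label R p
      ... | M , y∈ , eq with (M , d) ≟c (L , c)
      ... | yes refl = inj₁ (sym eq , refl)
      ... | no neq   = inj₂ (M , y∈ , neq , eq)
      rightmost : ∀ d → (s , d) ∈ T → d ≤ c
      rightmost d p with labels p
      ... | inj₁ (_ , refl) = ≤-refl
      ... | inj₂ (M , y∈ , _ , eq) = ≮⇒≥ blocked
        where
        blocked : ¬ (c < d)
        blocked c<d with <-cmp M L
        -- The northeast property puts `(L , d)` in `D`. Its height would exceed `s`, yet the weak
        -- decrease bounds it by `h L c`, which is below `s`.
        ... | tri< M<L _ _  = <⇒≱ (<-trans (n<1+n (h L c)) (subst (_< h L d) eq (increasing V y∈ z∈ M<L)))
                                  (decreasing V x∈ z∈ c<d)
          where
          z∈ : (L , d) ∈ D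
          z∈ = northeast y∈ x∈ (<⇒≤ M<L) (<⇒≤ c<d)
        ... | tri≈ _ refl _ = <⇒≱ (≤-reflexive (sym eq)) (decreasing V x∈ y∈ c<d)
        ... | tri> _ _ L<M  = <⇒≱ L<M (subst (_≤ L) (trans (sym eq) (above L<M y∈)) h<L)
      hole : (h L c , c) ∉ T
      hole p with labels p
      ... | inj₁ (eq , _)            = m≢1+n+m (h L c) {0} eq
      ... | inj₂ (M , y∈ , neq , eq) = neq (cong (_, c) (injective V y∈ x∈ eq))
      lab : ∀ {t d} → (t , d) ∈ moveCell s c (h L c) T → ∃[ M ] ((M , d) ∈ D × h M d ≡ t)
      lab p with ∈-moveCell⁻ {s} {c} {h L c} {T} p
      ... | inj₁ refl = L , x∈ , refl
      ... | inj₂ (q , neq) with labels q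
      ... | inj₁ (refl , refl)     = ⊥-elim (neq refl)
      ... | inj₂ (M , y∈ , _ , eq) = M , y∈ , eq
      img : ∀ {M d} → (M , d) ∈ D → (h M d , d) ∈ moveCell s c (h L c) T
      img {M} {d} y∈ with (M , d) ≟c (L , c)
      ... | yes refl = here refl
      ... | no neq   = ∈-moveCell⁺ (image-≡ R y∈ (update-≢ h neq)) λ eq →
        neq (cong₂ _,_ (injective V⁺ y∈ (subst (λ e → (L , e) ∈ D) (sym (,-injectiveʳ eq)) x∈)
                         (trans (update-≢ h neq) (trans (,-injectiveˡ eq)
                           (trans (sym (update-eq h L c s)) (cong (h⁺ L) (sym (,-injectiveʳ eq)))))))
                       (,-injectiveʳ eq))

  -- The recursion leads from `h` back to the heights of `D` itself: labels from the highest down,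
  -- columns from left to right, each cell raised one row at a time up to its label. This order
  -- supplies the hypotheses of `raise`; the moves are appended as the recursion returns.
  realise : (∀ {L c} → (L , c) ∈ D → 1 ≤ L) → ∀ {h} → Valid h → ∃[ T ] (Reachable D T × Represents h T)
  realise 1≤ {h} V with bound D
  ... | N , ≤N = go N (suc N) 0 (+-identityʳ (suc N)) V (λ N<M x∈ → ⊥-elim (<⇒≱ N<M (proj₁ (≤N x∈)))) (λ ())
    where
    Goal : (ℕ → ℕ → ℕ) → Set
    Goal h = ∃[ T ] (Reachable D T × Represents h T)
    Fixed : (ℕ → ℕ → ℕ) → ℕ → Set
    Fixed h L = ∀ {M d} → L < M → (M , d) ∈ D → h M d ≡ M
    FixedLeft : (ℕ → ℕ → ℕ) → ℕ → ℕ → Set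
    FixedLeft h L c = ∀ {d} → d < c → (L , d) ∈ D → h L d ≡ L

    fixedLeft-suc : ∀ h {L c} → FixedLeft h L c → ((L , c) ∈ D → h L c ≡ L) → FixedLeft h L (suc c)
    fixedLeft-suc h left eq d≤c y∈ with m≤n⇒m<n∨m≡n (s≤s⁻¹ d≤c)
    ... | inj₁ d<c  = left d<c y∈
    ... | inj₂ refl = eq y∈

    -- `m` counts the raises left for this cell, and the continuation `next` is the rest of the
    -- sweep, which starts once the cell is fixed.
    cell : ∀ {L c} → (L , c) ∈ D →
           (∀ {h} → Valid h → Fixed h L → FixedLeft h L (suc c) → Goal h) →
           ∀ m {h} → m + h L c ≡ L → Valid h → Fixed h L → FixedLeft h L c → Goal h
    cell x∈ next zero {h} eq V above left = next V above (fixedLeft-suc h left λ _ → eq)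
    cell {L} {c} x∈ next (suc m) {h} eq V above left
      with raise V x∈ (subst (h L c <_) eq (s≤s (m≤n+m _ m))) above left
    ... | V⁺ , lower
      with cell x∈ next m (trans (cong (m +_) (update-eq h L c _)) (trans (+-suc m _) eq)) V⁺
             (λ {M} L<M y∈ → trans (update-≢ h (λ p → <-irrefl (sym (,-injectiveˡ p)) L<M)) (above L<M y∈))
             (λ d<c y∈ → trans (update-≢ h {L} {c} (λ p → <-irrefl (,-injectiveʳ p) d<c)) (left d<c y∈))
    ... | T , D⟶T , R with lower R
    ... | T′ , move , R′ = T′ , step D⟶T move , R′

    column : ∀ {L c} → Dec ((L , c) ∈ D) →
             (∀ {h} → Valid h → Fixed h L → FixedLeft h L (suc c) → Goal h) →
             ∀ {h} → Valid h → Fixed h L → FixedLeft h L c → Goal h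
    column {L} {c} (yes x∈) next {h} V above left = cell x∈ next (L ∸ h L c) (m∸n+n≡m (bounded V x∈)) V above left
    column (no x∉) next {h} V above left = next V above (fixedLeft-suc h left λ x∈ → ⊥-elim (x∉ x∈))

    go : ∀ L k c → k + c ≡ suc N → ∀ {h} → Valid h → Fixed h L → FixedLeft h L c → Goal h
    go zero k c _ V above _ =
      D , here , record { label = λ x∈ → _ , x∈ , above (1≤ x∈) x∈
                        ; image = λ x∈ → subst (λ r → (r , _) ∈ D) (sym (above (1≤ x∈) x∈)) x∈ }
    -- Here `c` is `suc N`, past every column, so the label `suc L` is fixed throughout and the
    -- sweep passes to the label below.
    go (suc L) zero c refl {h} V above left = go L (suc N) 0 (+-identityʳ (suc N)) V above′ (λ ())
      where
      above′ : Fixed h L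
      above′ L<M x∈ with m≤n⇒m<n∨m≡n L<M
      ... | inj₁ L+1<M = above L+1<M x∈
      ... | inj₂ refl  = left (s≤s (proj₂ (≤N x∈))) x∈
    go (suc L) (suc k) c eq = column ((suc L , c) ∈? D) (go (suc L) k (suc c) (trans (+-suc k c) eq))

  -- Empty positions in a column

  vacancy : {P : Set} → Dec P → ℕ
  vacancy (yes _) = 0
  vacancy (no _)  = 1

  empties : ℕ → ℕ → ℕ
  empties c zero    = 0
  empties c (suc n) = vacancy ((suc n , c) ∈? D) + empties c n

  empties-full : ∀ {c n} → (suc n , c) ∈ D → empties c (suc n) ≡ empties c n
  empties-full {c} {n} x∈ with (suc n , c) ∈? D
  ... | yes _ = refl
  ... | no x∉ = ⊥-elim (x∉ x∈)

  empties-empty : ∀ {c n} → (suc n , c) ∉ D → empties c (suc n) ≡ suc (empties c n)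
  empties-empty {c} {n} x∉ with (suc n , c) ∈? D
  ... | yes x∈ = ⊥-elim (x∉ x∈)
  ... | no _   = refl

  empties-mono : ∀ c {m n} → m ≤ n → empties c m ≤ empties c n
  empties-mono c {m} {zero}  z≤n = ≤-refl
  empties-mono c {m} {suc n} m≤1+n with m≤n⇒m<n∨m≡n m≤1+n
  ... | inj₁ m≤n  = ≤-trans (empties-mono c (s≤s⁻¹ m≤n)) (m≤n+m _ _)
  ... | inj₂ refl = ≤-refl

  -- Each further row adds at most one empty position; the additive form avoids truncated
  -- subtraction.
  empties-lipschitz : ∀ c {m n} → m ≤ n → empties c n + m ≤ empties c m + n
  empties-lipschitz c {m} {zero}  z≤n = ≤-refl
  empties-lipschitz c {m} {suc n} m≤1+n with m≤n⇒m<n∨m≡n m≤1+n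
  ... | inj₂ refl = ≤-refl
  ... | inj₁ m≤n with (suc n , c) ∈? D
  ... | yes _ = ≤-trans (empties-lipschitz c (s≤s⁻¹ m≤n)) (+-monoʳ-≤ (empties c m) (n≤1+n n))
  ... | no _  = ≤-trans (s≤s (empties-lipschitz c (s≤s⁻¹ m≤n))) (≤-reflexive (sym (+-suc (empties c m) n)))

  empties-≤ : ∀ c n → empties c n ≤ n
  empties-≤ c n = subst (_≤ n) (+-identityʳ _) (empties-lipschitz c {0} {n} z≤n)

  -- The position found is the topmost empty one. The last clause says that at most one empty
  -- position is lost by passing below it, so that a second search can follow.
  ∃-empty : ∀ c n → 1 ≤ empties c n →
            ∃[ r ] (1 ≤ r × r ≤ n × (r , c) ∉ D × empties c n ≤ suc (empties c (pred r)))
  ∃-empty c (suc n) 1≤ with (suc n , c) ∈? D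
  ... | no x∉ = suc n , s≤s z≤n , ≤-refl , x∉ , ≤-refl
  ... | yes _ = let r , 1≤r , r≤n , x∉ , E≤ = ∃-empty c n 1≤ in r , 1≤r , m≤n⇒m≤1+n r≤n , x∉ , E≤

  TwoEmpty : ℕ → ℕ → Set
  TwoEmpty c n = ∃[ r ] ∃[ r′ ] (r ≢ r′ × 1 ≤ r × r ≤ n × 1 ≤ r′ × r′ ≤ n × (r , c) ∉ D × (r′ , c) ∉ D)

  ∃-two-empty : ∀ c n → 2 ≤ empties c n → TwoEmpty c n
  ∃-two-empty c n 2≤ with ∃-empty c n (≤-trans (s≤s z≤n) 2≤)
  ... | suc r , 1≤r , r≤n , x∉ , E≤ with ∃-empty c r (s≤s⁻¹ (≤-trans 2≤ E≤))
  ... | r′ , 1≤r′ , r′≤r , y∉ , _ =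
    suc r , r′ , (λ { refl → <-irrefl refl r′≤r }) , 1≤r , r≤n , 1≤r′
    , ≤-trans r′≤r (≤-trans (n≤1+n r) r≤n) , x∉ , y∉

  empty⇒empties : ∀ {c r n} → 1 ≤ r → r ≤ n → (r , c) ∉ D → 1 ≤ empties c n
  empty⇒empties {c} {suc r} _ r≤n x∉ =
    ≤-trans (subst (1 ≤_) (sym (empties-empty x∉)) (s≤s z≤n)) (empties-mono c r≤n)

  empty<empty⇒empties : ∀ {c r r′ n} → 1 ≤ r → r < r′ → r′ ≤ n →
                        (r , c) ∉ D → (r′ , c) ∉ D → 2 ≤ empties c n
  empty<empty⇒empties {c} {r} {suc r′} 1≤r r<r′ r′≤n x∉ y∉ =
    ≤-trans (subst (2 ≤_) (sym (empties-empty y∉)) (s≤s (empty⇒empties 1≤r (s≤s⁻¹ r<r′) x∉))) (empties-mono c r′≤n)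

  two-empty⇒empties : ∀ {c n} → TwoEmpty c n → 2 ≤ empties c n
  two-empty⇒empties {c} {n} (r , r′ , r≢r′ , 1≤r , r≤n , 1≤r′ , r′≤n , x∉ , y∉) with <-cmp r r′
  ... | tri< r<r′ _ _ = empty<empty⇒empties 1≤r r<r′ r′≤n x∉ y∉
  ... | tri≈ _ r≡r′ _ = ⊥-elim (r≢r′ r≡r′)
  ... | tri> _ _ r′<r = empty<empty⇒empties 1≤r′ r′<r r≤n y∉ x∉

  -- The cells of the column in rows 1 to `n` have distinct positive heights below that of
  -- `(L , c)`, and there are `n` minus `empties c n` of them. Hence a cell can drop only as far as
  -- the empty positions below it allow.
  height+empties : ∀ {h c} → Valid h → ∀ n {L} → n < L → (L , c) ∈ D → n < h L c + empties c n
  height+empties V zero n<L x∈ = ≤-trans (positive V x∈) (m≤m+n _ _)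
  height+empties {h} {c} V (suc n) {L} n<L x∈ with (suc n , c) ∈? D
  ... | yes y∈ = ≤-trans (s≤s (height+empties V n ≤-refl y∈)) (+-monoˡ-≤ (empties c n) (increasing V y∈ x∈ n<L))
  ... | no _   = ≤-trans (s≤s (height+empties V n (<-trans (n<1+n n) n<L) x∈))
                         (≤-reflexive (sym (+-suc (h L c) (empties c n))))

  drop⇒empties : ∀ {h c n} → Valid h → (suc n , c) ∈ D → ∀ k → h (suc n) c + k ≤ suc n → k ≤ empties c n
  drop⇒empties {h} {c} {n} V x∈ k le =
    +-cancelˡ-≤ (h (suc n) c) k _ (≤-trans le (height+empties V n ≤-refl x∈))

  -- A column c′ > c with fewer than two empty positions up to row L₁ lies left of
  -- c₂, and then (L₁ , c′) takes over the role of (L₁ , c).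
  opposite-drops : ∀ {h h′ L₁ L₂ c₂ r} → Valid h → Valid h′ → ¬ BadPair D →
    (L₂ , c₂) ∈ D → L₁ < L₂ → r ≤ L₁ → h L₂ c₂ < r →
    ∀ k {c} → c₂ ≤ k + c → c < c₂ → (L₁ , c) ∈ D → h′ L₁ c < r → ⊥
  opposite-drops V V′ ¬bad y∈ L₁<L₂ r≤L₁ h<r zero c₂≤c c<c₂ _ _ = <⇒≱ c<c₂ c₂≤c
  opposite-drops {L₁ = zero} V V′ ¬bad y∈ L₁<L₂ z≤n () (suc k)
  opposite-drops {h} {h′} {suc n} {L₂} {c₂} {r} V V′ ¬bad y∈ L₁<L₂ r≤L₁ h<r (suc k) {c} c₂≤k+c c<c₂ x∈ h′<r =
    ¬bad (suc n , c , L₂ , c₂ , x∈ , y∈ , L₁<L₂ , c<c₂ , hole , holes)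
    where
    hole : ∃[ s ] (1 ≤ s × s < suc n × (s , c) ∉ D)
    hole with ∃-empty c n (drop⇒empties V′ x∈ 1 (subst (_≤ suc n) (+-comm 1 _) (≤-trans h′<r r≤L₁)))
    ... | s , 1≤s , s≤n , z∉ , _ = s , 1≤s , s≤s s≤n , z∉
    holes : ∀ c′ → c < c′ → TwoEmpty c′ (suc n)
    holes c′ c<c′ with (suc n , c′) ∈? D
    -- A cell of column `c′` at or below row `L₁` would, with `(L₁ , c)`, force `(L₁ , c′)` into
    -- `D`. So rows 1 and 2 are both empty there; row 2 is in range because `1 ≤ h′ L₁ c < r ≤ L₁`.
    ... | no z∉ = 1 , 2 , (λ ()) , s≤s z≤n , s≤s z≤n , s≤s z≤n , 2≤L₁ , empty (s≤s z≤n) , empty 2≤L₁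
      where
      2≤L₁ : 2 ≤ suc n
      2≤L₁ = ≤-trans (s≤s (positive V′ x∈)) (≤-trans h′<r r≤L₁)
      empty : ∀ {s} → s ≤ suc n → (s , c′) ∉ D
      empty s≤L₁ w∈ = z∉ (northeast w∈ x∈ s≤L₁ (<⇒≤ c<c′))
    ... | yes z∈ with 2 ≤? empties c′ (suc n)
    ... | yes 2≤ = ∃-two-empty c′ (suc n) 2≤
    ... | no 2≰ with c′ <? c₂
    ... | yes c′<c₂ = ⊥-elim (opposite-drops V V′ ¬bad y∈ L₁<L₂ r≤L₁ h<r k
                        (≤-trans c₂≤k+c (subst (_≤ k + c′) (+-suc k c) (+-monoʳ-≤ k c<c′))) c′<c₂ z∈
                        (≤-<-trans (decreasing V′ x∈ z∈ c<c′) h′<r))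
    -- Now `(L₂ , c′)` is a cell, and `h L₁ c′ < h L₂ c′ ≤ h L₂ c₂ < r ≤ L₁`: the two strict steps
    -- give a drop of at least two, hence two empty positions.
    ... | no c′≮c₂ = ⊥-elim (2≰ (≤-trans (drop⇒empties V z∈ 2 drop₂) (empties-mono c′ (n≤1+n n))))
      where
      c₂≤c′ : c₂ ≤ c′
      c₂≤c′ = ≮⇒≥ c′≮c₂
      w∈ : (L₂ , c′) ∈ D
      w∈ = northeast z∈ y∈ (<⇒≤ L₁<L₂) c₂≤c′
      drop₂ : h (suc n) c′ + 2 ≤ suc n
      drop₂ = subst (_≤ suc n) (+-comm 2 _)
        (≤-trans (s≤s (≤-trans (increasing V z∈ w∈ L₁<L₂) (decreasing-≤ V y∈ w∈ c₂≤c′))) (≤-trans h<r r≤L₁))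

  -- Comparison of two diagrams of equal weight from the top row down

  Agree : ℕ → Diagram → Diagram → Set
  Agree r T T′ = ∀ {s d} → r < s → (s , d) ∈ T → (s , d) ∈ T′

  -- Above row `r` both diagrams have the same positions in the column, and strict increase forces
  -- the same labels on them, read from the top. The induction goes down in `L`, with `k` as
  -- measure.
  agree-heights : ∀ {N r} → (∀ {L c} → (L , c) ∈ D → L ≤ N) → ∀ k {h h′ T T′ L c} →
    Valid h → Valid h′ → Represents h T → Represents h′ T′ → Agree r T T′ → Agree r T′ T →
    N < k + L → (L , c) ∈ D → r < h L c → h′ L c ≡ h L c
  agree-heights ≤N zero V V′ R R′ A A′ N<L x∈ r<h = ⊥-elim (<⇒≱ N<L (≤N x∈))
  agree-heights {N} {r} ≤N (suc k) {h} {h′} {L = L} {c} V V′ R R′ A A′ N<k+L x∈ r<h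
    with label R′ (A r<h (image R x∈))
  ... | M , y∈ , eq with <-cmp M L
  ... | tri≈ _ refl _ = eq
  ... | tri> _ _ L<M = ⊥-elim (<-irrefl (injective V x∈ y∈ (trans (sym eq) (sym same))) L<M)
    where
    same : h M c ≡ h′ M c
    same = agree-heights ≤N k V′ V R′ R A′ A
             (<-≤-trans N<k+L (subst (_≤ k + M) (+-suc k L) (+-monoʳ-≤ k L<M))) y∈ (subst (r <_) (sym eq) r<h)
  -- The position `h′ L c` lies even higher, so in `T` it belongs to some label `K` above `L`. By
  -- induction `K` has the same height under `h′`, where it collides with `L`.
  ... | tri< M<L _ _ = ⊥-elim (<-irrefl (injective V′ x∈ (proj₁ (proj₂ higher)) (trans (sym (proj₂ (proj₂ higher))) (sym same))) L<K)
    where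
    h<h′ : h L c < h′ L c
    h<h′ = subst (_< h′ L c) eq (increasing V′ y∈ x∈ M<L)
    higher = label R (A′ (<-trans r<h h<h′) (image R′ x∈))
    K = proj₁ higher
    h<hK : h L c < h K c
    h<hK = subst (h L c <_) (sym (proj₂ (proj₂ higher))) h<h′
    L<K : L < K
    L<K = reflects-< V x∈ (proj₁ (proj₂ higher)) h<hK
    same : h′ K c ≡ h K c
    same = agree-heights ≤N k V V′ R R′ A A′
             (<-≤-trans N<k+L (subst (_≤ k + K) (+-suc k L) (+-monoʳ-≤ k L<K)))
             (proj₁ (proj₂ higher)) (<-trans r<h h<hK)

  -- Each of the two cells must lie below row `r` in the other diagram, since heights above `r`
  -- agree. If `L₂ ≤ L₁`, then `(L₁ , c₂)` would be a cell with height under `h′` both at least `r`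
  -- and below `r`; so `L₁ < L₂`, and `opposite-drops` applies.
  conflict : ∀ {r h h′ T T′ c₁ c₂} → ¬ BadPair D →
    Valid h → Valid h′ → Represents h T → Represents h′ T′ → Agree r T T′ → Agree r T′ T →
    c₁ < c₂ → (r , c₁) ∈ T → (r , c₁) ∉ T′ → (r , c₂) ∈ T′ → (r , c₂) ∉ T → ⊥
  conflict {r} {h} {h′} {T} {T′} {c₁} {c₂} ¬bad V V′ R R′ A A′ c₁<c₂ p₁ p₁∉ p₂ p₂∉
    with bound D | label R p₁ | label R′ p₂
  ... | N , ≤N | L₁ , x∈ , eq₁ | L₂ , y∈ , eq =
    opposite-drops V V′ ¬bad y∈ L₁<L₂ (subst (_≤ L₁) eq₁ (bounded V x∈))
      (lower V V′ R R′ A A′ y∈ eq p₂∉) c₂ (m≤m+n c₂ c₁) c₁<c₂ x∈ h′x<r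
    where
    lower : ∀ {g g′ S S′ L c} → Valid g → Valid g′ → Represents g S → Represents g′ S′ →
            Agree r S S′ → Agree r S′ S → (L , c) ∈ D → g′ L c ≡ r → (r , c) ∉ S → g L c < r
    lower {g} {g′} {S} {S′} {L} {c} W W′ Q Q′ B B′ z∈ g′≡r ∉S with <-cmp (g L c) r
    ... | tri< lt _ _ = lt
    ... | tri≈ _ e _  = ⊥-elim (∉S (image-≡ Q z∈ e))
    ... | tri> _ _ gt = ⊥-elim (<-irrefl (trans (sym g′≡r) (agree-heights (λ w∈ → proj₁ (≤N w∈)) (suc N)
                          W W′ Q Q′ B B′ (m≤m+n (suc N) L) z∈ gt)) gt)
    h′x<r : h′ L₁ c₁ < r
    h′x<r = lower V′ V R′ R A′ A x∈ eq₁ p₁∉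
    L₁<L₂ : L₁ < L₂
    L₁<L₂ = ≰⇒> λ L₂≤L₁ →
      let z∈ = northeast y∈ x∈ L₂≤L₁ (<⇒≤ c₁<c₂)
          h′y≤h′z = monotone L₂≤L₁ y∈ z∈
      in <⇒≱ (≤-<-trans (decreasing V′ x∈ z∈ c₁<c₂) h′x<r) (subst (_≤ h′ L₁ c₂) eq h′y≤h′z)
      where
      monotone : ∀ {L M c} → L ≤ M → (L , c) ∈ D → (M , c) ∈ D → h′ L c ≤ h′ M c
      monotone L≤M a b with m≤n⇒m<n∨m≡n L≤M
      ... | inj₁ L<M  = <⇒≤ (increasing V′ a b L<M)
      ... | inj₂ refl = ≤-refl

  row-⊆ : ∀ {r h h′ T T′} → ¬ BadPair D → Valid h → Valid h′ → Represents h T → Represents h′ T′ →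
    Agree r T T′ → Agree r T′ T → Unique T′ → rowCount T r ≡ rowCount T′ r →
    ∀ {c} → (r , c) ∈ T → (r , c) ∈ T′
  row-⊆ {r} {T = T} {T′} ¬bad V V′ R R′ A A′ u′ eq {c} p = decidable-stable ((r , c) ∈? T′) λ p∉ →
    let d , q , q∉ = row-exchange u′ eq p p∉ in absurd p∉ q q∉ (<-cmp c d)
    where
    absurd : ∀ {d} → (r , c) ∉ T′ → (r , d) ∈ T′ → (r , d) ∉ T → Tri (c < d) (c ≡ d) (d < c) → ⊥
    absurd p∉ q q∉ (tri< c<d _ _)  = conflict ¬bad V V′ R R′ A A′ c<d p p∉ q q∉
    absurd p∉ q q∉ (tri≈ _ refl _) = p∉ q
    absurd p∉ q q∉ (tri> _ _ d<c)  = conflict ¬bad V′ V R′ R A′ A d<c q q∉ p p∉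

  free : WellFormed D → ¬ BadPair D → MultiplicityFree D
  free (u , 1≤) ¬bad T T′ D⟶T D⟶T′ same
    with bound D | heights (λ x∈ → proj₁ (1≤ _ _ x∈)) D⟶T | heights (λ x∈ → proj₁ (1≤ _ _ x∈)) D⟶T′
  ... | N , ≤N | h , V , R | h′ , V′ , R′ =
    λ (r , c) → mk⇔ (λ p → proj₁ (agree N 0 (m≤m+n N 0)) (row-pos V R p) p)
                    (λ p → proj₂ (agree N 0 (m≤m+n N 0)) (row-pos V′ R′ p) p)
    where
    row-pos : ∀ {h T r c} → Valid h → Represents h T → (r , c) ∈ T → 0 < r
    row-pos V R p with label R p
    ... | L , x∈ , refl = positive V x∈
    row-≤ : ∀ {h T r c} → Valid h → Represents h T → (r , c) ∈ T → r ≤ N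
    row-≤ V R p with label R p
    ... | L , x∈ , refl = ≤-trans (bounded V x∈) (proj₁ (≤N x∈))
    -- Above row `N` both diagrams are empty; every step down adds one row, and row 0 is reached
    -- because all cells lie in positive rows.
    agree : ∀ k r → N ≤ k + r → Agree r T T′ × Agree r T′ T
    agree zero r N≤r = (λ r<s p → ⊥-elim (<⇒≱ (≤-<-trans N≤r r<s) (row-≤ V R p)))
                     , (λ r<s p → ⊥-elim (<⇒≱ (≤-<-trans N≤r r<s) (row-≤ V′ R′ p)))
    agree (suc k) r N≤k+r with agree k (suc r) (subst (N ≤_) (sym (+-suc k r)) N≤k+r)
    ... | A , A′ =
        extend A  (row-⊆ ¬bad V V′ R R′ A A′ (Reachable-Unique u D⟶T′) (same (suc r)))
      , extend A′ (row-⊆ ¬bad V′ V R′ R A′ A (Reachable-Unique u D⟶T) (sym (same (suc r))))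
      where
      extend : ∀ {S S′} → Agree (suc r) S S′ → (∀ {c} → (suc r , c) ∈ S → (suc r , c) ∈ S′) → Agree r S S′
      extend B atRow r<s p with m≤n⇒m<n∨m≡n r<s
      ... | inj₁ 1+r<s = B 1+r<s p
      ... | inj₂ refl  = atRow p

  -- Two diagrams of equal weight from a bad pair

  -- Above row `L`, each cell of column `c` forces, with `(L , d)`, a cell of column `d` in its row.
  -- Thus column `d` has no more empty positions in that range than column `c`.
  empties-antitone : ∀ {L c d} → (L , d) ∈ D → c ≤ d → ∀ k →
                     empties d (k + L) + empties c L ≤ empties c (k + L) + empties d L
  empties-antitone {L} {c} {d} y∈ c≤d zero = ≤-reflexive (+-comm (empties d L) (empties c L))
  empties-antitone {L} {c} {d} y∈ c≤d (suc k) with (suc k + L , d) ∈? D | (suc k + L , c) ∈? D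
  ... | yes _ | yes _ = empties-antitone y∈ c≤d k
  ... | yes _ | no _  = m≤n⇒m≤1+n (empties-antitone y∈ c≤d k)
  ... | no _  | no _  = s≤s (empties-antitone y∈ c≤d k)
  ... | no z∉ | yes z∈ = ⊥-elim (z∉ (northeast y∈ z∈ (m≤n+m L (suc k)) c≤d))

  module Sinking {q c₁ : ℕ} (x₁∈ : (suc q , c₁) ∈ D) (1≤q : 1 ≤ q)
    (1≤rows : ∀ {L c} → (L , c) ∈ D → 1 ≤ L)
    (one-empty : 1 ≤ empties c₁ (suc q))
    (two-empty : ∀ {c} → c₁ < c → 2 ≤ empties c (suc q)) where

    r₁ : ℕ
    r₁ = suc q

    -- How far below row r₁ the cells of column c with labels ≤ r₁ are pushed:
    -- 0, 1 or 2 rows according to whether c < c₁, c = c₁ or c > c₁.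
    depth : ℕ → ℕ
    depth c = 2 ⊓ (suc c ∸ c₁)

    depth-left : ∀ {c} → c < c₁ → depth c ≡ 0
    depth-left c<c₁ = cong (2 ⊓_) (m≤n⇒m∸n≡0 c<c₁)

    depth-at : depth c₁ ≡ 1
    depth-at = cong (2 ⊓_) (m+n∸n≡m 1 c₁)

    depth-right : ∀ {c} → c₁ < c → depth c ≡ 2
    depth-right {c} c₁<c = m≤n⇒m⊓n≡m (m+n≤o⇒m≤o∸n 2 (s≤s c₁<c))

    depth-mono : ∀ {c d} → c ≤ d → depth c ≤ depth d
    depth-mono c≤d = ⊓-monoʳ-≤ 2 (∸-monoˡ-≤ c₁ (s≤s c≤d))

    depth≤empties : ∀ c → depth c ≤ empties c r₁
    depth≤empties c with <-cmp c c₁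
    ... | tri< c<c₁ _ _ = subst (_≤ empties c r₁) (sym (depth-left c<c₁)) z≤n
    ... | tri≈ _ refl _ = subst (_≤ empties c r₁) (sym depth-at) one-empty
    ... | tri> _ _ c₁<c = subst (_≤ empties c r₁) (sym (depth-right c₁<c)) (two-empty c₁<c)

    -- For `L ≤ r₁` this counts the empty positions of column `c` in rows `L + 1` to `r₁`. They
    -- absorb part of the push, so `sink` lowers a cell only by what remains of `depth c`.
    slack : ℕ → ℕ → ℕ
    slack L c = empties c r₁ ∸ empties c L

    sink : ℕ → ℕ → ℕ
    sink L c = L ∸ (depth c ∸ slack L c)

    -- The drop is at most the number of empty positions below the cell, so the subtraction in
    -- `sink` leaves a positive row.
    sink-drop : ∀ {n c} → (suc n , c) ∈ D → suc n ≤ r₁ → depth c ∸ slack (suc n) c ≤ n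
    sink-drop {n} {c} x∈ L≤r₁ = begin
      depth c ∸ slack (suc n) c             ≤⟨ ∸-monoˡ-≤ (slack (suc n) c) (depth≤empties c) ⟩
      empties c r₁ ∸ slack (suc n) c        ≡⟨ m∸[m∸n]≡n (empties-mono c L≤r₁) ⟩
      empties c (suc n)                     ≡⟨ empties-full x∈ ⟩
      empties c n                           ≤⟨ empties-≤ c n ⟩
      n                                     ∎
      where open ≤-Reasoning

    sink-positive : ∀ {L c} → (L , c) ∈ D → L ≤ r₁ → 1 ≤ sink L c
    sink-positive {zero}  x∈ _    = ⊥-elim (<-irrefl refl (1≤rows x∈))
    sink-positive {suc n} x∈ L≤r₁ = m<n⇒0<n∸m (s≤s (sink-drop x∈ L≤r₁))

    -- From `M` down to `L` the drop shrinks by at most the number `e` of empty positions between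
    -- them, and those same positions already separate the two labels.
    sink-increasing : ∀ {L M c} → (M , c) ∈ D → L < M → M ≤ r₁ → sink L c < sink M c
    sink-increasing {L} {suc m} {c} y∈ (s≤s L≤m) M≤r₁ = begin
      suc (L ∸ (depth c ∸ slack L c))                ≡⟨ cong (λ t → suc (L ∸ (depth c ∸ t))) slack-split ⟩
      suc (L ∸ (depth c ∸ (slack (suc m) c + e)))    ≡⟨ cong (λ t → suc (L ∸ t)) (sym (∸-+-assoc (depth c) (slack (suc m) c) e)) ⟩
      suc (L ∸ (d ∸ e))                              ≤⟨ s≤s (m∸[n∸o]≤m+o∸n L d e) ⟩
      suc ((L + e) ∸ d)                              ≤⟨ s≤s (∸-monoˡ-≤ d L+e≤m) ⟩
      suc (m ∸ d)                                    ≡⟨ sym (+-∸-assoc 1 (sink-drop y∈ M≤r₁)) ⟩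
      suc m ∸ d                                      ∎
      where
      open ≤-Reasoning
      d = depth c ∸ slack (suc m) c
      e = empties c (suc m) ∸ empties c L
      slack-split : slack L c ≡ slack (suc m) c + e
      slack-split = trans (cong (_∸ empties c L) (sym (m∸n+n≡m (empties-mono c M≤r₁))))
                          (+-∸-assoc (slack (suc m) c) (empties-mono c (m≤n⇒m≤1+n L≤m)))
      L+e≤m : L + e ≤ m
      L+e≤m = subst (λ t → L + (t ∸ empties c L) ≤ m) (sym (empties-full y∈))
                    (m+[n∸o]≤p (empties-mono c L≤m) (empties-lipschitz c L≤m))

    slack-antitone : ∀ {L c d} → (L , d) ∈ D → c ≤ d → L ≤ r₁ → slack L d ≤ slack L c
    slack-antitone {L} {c} {d} y∈ c≤d L≤r₁ =
      m≤n+o⇒m∸n≤o (empties d r₁) (empties d L)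
        (subst (empties d r₁ ≤_) (+-∸-assoc (empties d L) (empties-mono c L≤r₁))
          (m+n≤o⇒m≤o∸n (empties d r₁) (subst (empties d r₁ + empties c L ≤_) (+-comm (empties c r₁) (empties d L))
            (subst (λ n → empties d n + empties c L ≤ empties c n + empties d L) (m∸n+n≡m L≤r₁)
              (empties-antitone y∈ c≤d (r₁ ∸ L))))))

    sink-decreasing : ∀ {L c d} → (L , d) ∈ D → c ≤ d → L ≤ r₁ → sink L d ≤ sink L c
    sink-decreasing {L} y∈ c≤d L≤r₁ = ∸-monoʳ-≤ L (∸-mono (depth-mono c≤d) (slack-antitone y∈ c≤d L≤r₁))

    sink-top : ∀ c → sink r₁ c ≡ r₁ ∸ depth c
    sink-top c = cong (λ t → r₁ ∸ (depth c ∸ t)) (n∸n≡0 (empties c r₁))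

    sink-≤ : ∀ {L} c → L ≤ r₁ → sink L c ≤ r₁ ∸ depth c
    sink-≤ {L} c L≤r₁ = ≤-trans (m∸[n∸o]≤m+o∸n L (depth c) (slack L c)) (∸-monoˡ-≤ (depth c) L+slack≤r₁)
      where
      L+slack≤r₁ : L + slack L c ≤ r₁
      L+slack≤r₁ = m+[n∸o]≤p (empties-mono c L≤r₁) (empties-lipschitz c L≤r₁)

    base : ℕ → ℕ → ℕ
    base L c with L ≤? r₁
    ... | yes _ = sink L c
    ... | no _  = L

    base-low : ∀ {L} c → L ≤ r₁ → base L c ≡ sink L c
    base-low {L} c L≤r₁ with L ≤? r₁
    ... | yes _ = refl
    ... | no L≰ = ⊥-elim (L≰ L≤r₁)

    base-high : ∀ {L} c → r₁ < L → base L c ≡ L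
    base-high {L} c r₁<L with L ≤? r₁
    ... | yes L≤ = ⊥-elim (<⇒≱ r₁<L L≤)
    ... | no _   = refl

    base-top : ∀ c → base r₁ c ≡ r₁ ∸ depth c
    base-top c = trans (base-low c ≤-refl) (sink-top c)

    base-valid : Valid base
    base-valid = record { positive = pos ; bounded = bnd ; increasing = inc ; decreasing = dec }
      where
      pos : ∀ {L c} → (L , c) ∈ D → 1 ≤ base L c
      pos {L} x∈ with L ≤? r₁
      ... | yes L≤ = sink-positive x∈ L≤
      ... | no _   = 1≤rows x∈
      bnd : ∀ {L c} → (L , c) ∈ D → base L c ≤ L
      bnd {L} {c} x∈ with L ≤? r₁
      ... | yes _ = m∸n≤m L (depth c ∸ slack L c)
      ... | no _  = ≤-refl
      inc : ∀ {L M c} → (L , c) ∈ D → (M , c) ∈ D → L < M → base L c < base M c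
      inc {L} {M} {c} x∈ y∈ L<M with L ≤? r₁ | M ≤? r₁
      ... | yes _ | yes M≤ = sink-increasing y∈ L<M M≤
      ... | yes _ | no _   = ≤-<-trans (m∸n≤m L (depth c ∸ slack L c)) L<M
      ... | no L≰ | yes M≤ = ⊥-elim (L≰ (≤-trans (<⇒≤ L<M) M≤))
      ... | no _  | no _   = L<M
      dec : ∀ {L c d} → (L , c) ∈ D → (L , d) ∈ D → c < d → base L d ≤ base L c
      dec {L} x∈ y∈ c<d with L ≤? r₁
      ... | yes L≤ = sink-decreasing y∈ (<⇒≤ c<d) L≤
      ... | no _   = ≤-refl

    -- The last two hypotheses let the second cell come down alone: no cell of its row lies to its
    -- right, and no label of its column lies strictly between `r₁` and `r₂`.
    module Exchange {r₂ c₂ : ℕ} (x₂∈ : (r₂ , c₂) ∈ D) (r₁<r₂ : r₁ < r₂) (c₁<c₂ : c₁ < c₂)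
      (none-right : ∀ {M d} → r₁ < M → c₂ < d → (M , d) ∉ D)
      (none-between : ∀ {M} → r₁ < M → M < r₂ → (M , c₂) ∉ D) where

      placed : ℕ → ℕ → ℕ → ℕ → ℕ
      placed v₁ v₂ = (base [ r₁ , c₁ ↦ v₁ ]) [ r₂ , c₂ ↦ v₂ ]

      r₁≢r₂ : ∀ {c d} → _≢_ {A = Cell} (r₁ , c) (r₂ , d)
      r₁≢r₂ eq = <-irrefl (,-injectiveˡ eq) r₁<r₂

      placed-₁ : ∀ v₁ v₂ → placed v₁ v₂ r₁ c₁ ≡ v₁
      placed-₁ v₁ v₂ = trans (update-≢ (base [ r₁ , c₁ ↦ v₁ ]) r₁≢r₂) (update-eq base r₁ c₁ v₁)

      placed-₂ : ∀ v₁ v₂ → placed v₁ v₂ r₂ c₂ ≡ v₂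
      placed-₂ v₁ v₂ = update-eq (base [ r₁ , c₁ ↦ v₁ ]) r₂ c₂ v₂

      placed-other : ∀ v₁ v₂ {M d} → (M , d) ≢ (r₁ , c₁) → (M , d) ≢ (r₂ , c₂) → placed v₁ v₂ M d ≡ base M d
      placed-other v₁ v₂ ≢₁ ≢₂ = trans (update-≢ (base [ r₁ , c₁ ↦ v₁ ]) ≢₂) (update-≢ base ≢₁)

      -- `base` makes the room: in column `c₁` the labels below `r₁` lie under row `q`, and in
      -- column `c₂` the labels up to `r₁` lie at or below `r₁ ∸ 2`. Along row `r₁` the cells left
      -- of `c₁` stay at `r₁`, and those to the right sink to `q ∸ 1`.
      placed-valid : ∀ {v₁ v₂} → q ≤ v₁ → v₁ ≤ r₁ → q ≤ v₂ → v₂ ≤ r₁ → Valid (placed v₁ v₂)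
      placed-valid {v₁} {v₂} q≤v₁ v₁≤r₁ q≤v₂ v₂≤r₁ =
        update-valid valid₁ (≤-trans 1≤q q≤v₂) (≤-trans v₂≤r₁ (<⇒≤ r₁<r₂))
          (λ {M} M<r₂ y∈ → subst (_< v₂) (sym (column₂ M)) (below M<r₂ y∈))
          (λ {M} r₂<M y∈ → subst (v₂ <_) (sym (trans (column₂ M) (base-high c₂ (<-trans r₁<r₂ r₂<M))))
                         (≤-<-trans v₂≤r₁ (<-trans r₁<r₂ r₂<M)))
          (λ {d} d<c₂ y∈ → subst (v₂ ≤_) (sym (row₂ d)) (≤-trans v₂≤r₁ (<⇒≤ r₁<r₂)))
          (λ c₂<d y∈ → ⊥-elim (none-right r₁<r₂ c₂<d y∈))
        where
        valid₁ : Valid (base [ r₁ , c₁ ↦ v₁ ])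
        valid₁ = update-valid base-valid (≤-trans 1≤q q≤v₁) v₁≤r₁
          (λ {M} M<r₁ y∈ → <-≤-trans (increasing base-valid y∈ x₁∈ M<r₁)
                         (≤-trans (≤-reflexive (trans (base-top c₁) (cong (r₁ ∸_) depth-at))) q≤v₁))
          (λ {M} r₁<M y∈ → subst (v₁ <_) (sym (base-high c₁ r₁<M)) (≤-<-trans v₁≤r₁ r₁<M))
          (λ {d} d<c₁ y∈ → subst (v₁ ≤_) (sym (trans (base-top d) (cong (r₁ ∸_) (depth-left d<c₁)))) v₁≤r₁)
          (λ {d} c₁<d y∈ → subst (_≤ v₁) (sym (trans (base-top d) (cong (r₁ ∸_) (depth-right c₁<d))))
                         (≤-trans (m∸n≤m q 1) q≤v₁))
        column₂ : ∀ M → (base [ r₁ , c₁ ↦ v₁ ]) M c₂ ≡ base M c₂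
        column₂ M = update-≢ base {r₁} {c₁} {v₁} {M} (λ eq → <-irrefl (sym (,-injectiveʳ eq)) c₁<c₂)
        row₂ : ∀ d → (base [ r₁ , c₁ ↦ v₁ ]) r₂ d ≡ r₂
        row₂ d = trans (update-≢ base (λ eq → r₁≢r₂ (sym eq))) (base-high d r₁<r₂)
        below : ∀ {M} → M < r₂ → (M , c₂) ∈ D → base M c₂ < v₂
        below {M} M<r₂ y∈ with M ≤? r₁
        ... | no M≰  = ⊥-elim (none-between (≰⇒> M≰) M<r₂ y∈)
        ... | yes M≤ = ≤-<-trans (subst (λ t → sink M c₂ ≤ r₁ ∸ t) (depth-right c₁<c₂) (sink-≤ c₂ M≤))
                         (<-≤-trans (∸-monoʳ-< {q} {1} {0} (s≤s z≤n) 1≤q) q≤v₂)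

      others : Diagram
      others = removeCell (r₁ , c₁) (removeCell (r₂ , c₂) D)

      ∈-others : ∀ {x} → x ∈ others → x ∈ D × x ≢ (r₁ , c₁) × x ≢ (r₂ , c₂)
      ∈-others x∈ = let y∈ , ≢₁ = ∈-filter⁻ (λ y → ¬? (y ≟c (r₁ , c₁))) x∈
                        z∈ , ≢₂ = ∈-filter⁻ (λ y → ¬? (y ≟c (r₂ , c₂))) y∈
                    in z∈ , ≢₁ , ≢₂

      -- With the two exchanged cells in front, the weights of both placements are counted on lists
      -- with a common tail.
      reordered : Diagram
      reordered = (r₁ , c₁) ∷ (r₂ , c₂) ∷ others

      reordered-unique : Unique D → Unique reordered
      reordered-unique u =
          (r₁≢r₂ ∷ All.tabulate (λ y∈ eq → proj₁ (proj₂ (∈-others y∈)) (sym eq)))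
        ∷ All.tabulate (λ y∈ eq → proj₂ (proj₂ (∈-others y∈)) (sym eq))
        ∷ Unique-filter⁺ _ (Unique-filter⁺ _ u)

      reordered-≈ : reordered ≈D D
      reordered-≈ x = mk⇔ to from
        where
        to : x ∈ reordered → x ∈ D
        to (here refl)         = x₁∈
        to (there (here refl)) = x₂∈
        to (there (there x∈))  = proj₁ (∈-others x∈)
        from : x ∈ D → x ∈ reordered
        from x∈ with x ≟c (r₁ , c₁) | x ≟c (r₂ , c₂)
        ... | yes eq | _      = here eq
        ... | no _   | yes eq = there (here eq)
        ... | no ≢₁  | no ≢₂  = there (there
          (∈-filter⁺ (λ y → ¬? (y ≟c (r₁ , c₁))) (∈-filter⁺ (λ y → ¬? (y ≟c (r₂ , c₂))) x∈ ≢₂) ≢₁))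

      weight : ∀ {v₁ v₂ T} → Unique D → Unique T → Valid (placed v₁ v₂) → Represents (placed v₁ v₂) T → ∀ i →
        rowCount T i ≡ rowCount ((v₁ , c₁) ∷ (v₂ , c₂) ∷ map (λ (L , c) → base L c , c) others) i
      weight {v₁} {v₂} {T} u uT V R i =
        trans (rowCount-cong uT (Unique-map⁺ inj (reordered-unique u)) T≈ i)
              (cong (λ S → rowCount S i) (cong₂ _∷_ (cong (_, c₁) (placed-₁ v₁ v₂))
                (cong₂ _∷_ (cong (_, c₂) (placed-₂ v₁ v₂)) (map-cong-local (All.tabulate λ x∈ →
                  let _ , ≢₁ , ≢₂ = ∈-others x∈ in cong (_, _) (placed-other v₁ v₂ ≢₁ ≢₂))))))
        where
        φ : Cell → Cell
        φ (L , c) = placed v₁ v₂ L c , c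
        toD : ∀ {x} → x ∈ reordered → x ∈ D
        toD {x} = Equivalence.to (reordered-≈ x)
        inj : ∀ {x y} → x ∈ reordered → y ∈ reordered → φ x ≡ φ y → x ≡ y
        inj {L , c} {M , d} x∈ y∈ eq with ,-injectiveʳ eq
        ... | refl = cong (_, c) (injective V (toD x∈) (toD y∈) (,-injectiveˡ eq))
        T≈ : T ≈D map φ reordered
        T≈ (r , c) = mk⇔ to from
          where
          to : (r , c) ∈ T → (r , c) ∈ map φ reordered
          to p with label R p
          ... | L , x∈ , refl = ∈-map⁺ φ (Equivalence.from (reordered-≈ (L , c)) x∈)
          from : (r , c) ∈ map φ reordered → (r , c) ∈ T
          from p with ∈-map⁻ φ p
          ... | (L , d) , x∈ , refl = image R (toD x∈)

      not-free : Unique D → ¬ MultiplicityFree D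
      not-free u mf with placed-valid {r₁} {q} (n≤1+n q) ≤-refl ≤-refl (n≤1+n q)
                       | placed-valid {q} {r₁} ≤-refl (n≤1+n q) (n≤1+n q) ≤-refl
      ... | V | V′ with realise 1≤rows V | realise 1≤rows V′
      ... | T , D⟶T , R | T′ , D⟶T′ , R′ = x∉T′ (Equivalence.to (mf T T′ D⟶T D⟶T′ same (r₁ , c₁)) x∈T)
        where
        same : ∀ i → rowCount T i ≡ rowCount T′ i
        same i = trans (weight u (Reachable-Unique u D⟶T) V R i)
                   (trans (swapped (map (λ (L , c) → base L c , c) others)) (sym (weight u (Reachable-Unique u D⟶T′) V′ R′ i)))
          where
          δ : ℕ → ℕ
          δ r = if does (r ≟ i) then 1 else 0
          swapped : ∀ S → rowCount ((r₁ , c₁) ∷ (q , c₂) ∷ S) i ≡ rowCount ((q , c₁) ∷ (r₁ , c₂) ∷ S) i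
          swapped S = begin
            rowCount ((r₁ , c₁) ∷ (q , c₂) ∷ S) i   ≡⟨ rowCount-∷ r₁ c₁ _ i ⟩
            δ r₁ + rowCount ((q , c₂) ∷ S) i        ≡⟨ cong (δ r₁ +_) (rowCount-∷ q c₂ S i) ⟩
            δ r₁ + (δ q + rowCount S i)             ≡⟨ sym (+-assoc (δ r₁) (δ q) _) ⟩
            δ r₁ + δ q + rowCount S i               ≡⟨ cong (_+ rowCount S i) (+-comm (δ r₁) (δ q)) ⟩
            δ q + δ r₁ + rowCount S i               ≡⟨ +-assoc (δ q) (δ r₁) _ ⟩
            δ q + (δ r₁ + rowCount S i)             ≡⟨ cong (δ q +_) (sym (rowCount-∷ r₁ c₂ S i)) ⟩
            δ q + rowCount ((r₁ , c₂) ∷ S) i        ≡⟨ sym (rowCount-∷ q c₁ _ i) ⟩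
            rowCount ((q , c₁) ∷ (r₁ , c₂) ∷ S) i   ∎
            where open ≡-Reasoning
        x∈T : (r₁ , c₁) ∈ T
        x∈T = image-≡ R x₁∈ (placed-₁ r₁ q)
        x∉T′ : (r₁ , c₁) ∉ T′
        x∉T′ p with label R′ p
        -- No label can fill this position: smaller ones cannot rise to `r₁`, `r₁` itself is placed
        -- at `q`, and larger ones in column `c₁` keep their own rows.
        ... | M , y∈ , eq with <-cmp M r₁
        ... | tri< M<r₁ _ _ = <-irrefl eq (≤-<-trans (bounded V′ y∈) M<r₁)
        ... | tri≈ _ refl _ = m≢1+n+m q {0} (trans (sym (placed-₁ q r₁)) eq)
        ... | tri> _ _ r₁<M = <-irrefl (sym (trans (sym high) eq)) r₁<M
          where
          high : placed q r₁ M c₁ ≡ M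
          high = trans (placed-other q r₁ (λ e → <-irrefl (sym (,-injectiveˡ e)) r₁<M)
                                          (λ e → <-irrefl (,-injectiveʳ e) c₁<c₂))
                       (base-high c₁ r₁<M)

  not-free : WellFormed D → BadPair D → ¬ MultiplicityFree D
  not-free (u , 1≤) (suc q , c₁ , r₂ , c₂ , x₁∈ , x₂∈ , r₁<r₂ , c₁<c₂ , (r , 1≤r , r<r₁ , z∉) , holes) mf
    with bound D
  ... | N , ≤N = search (suc N) c₂ (s≤s (m≤m+n N c₂)) c₁<c₂ (suc r₂) r₂ ≤-refl r₁<r₂ x₂∈
    where
    module S = Sinking x₁∈ (≤-trans 1≤r (s≤s⁻¹ r<r₁)) (λ x∈ → proj₁ (1≤ _ _ x∈))
                 (empty⇒empties 1≤r (<⇒≤ r<r₁) z∉) (λ c₁<c → two-empty⇒empties (holes _ c₁<c))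
    -- Replaces the second cell by one with maximal column and then minimal row.
    search : ∀ k c → N < k + c → c₁ < c → ∀ l s → s < l → suc q < s → (s , c) ∈ D → ⊥
    search zero c N<c _ _ _ _ _ y∈ = <⇒≱ N<c (proj₂ (≤N y∈))
    search (suc k) c N<k+c c₁<c (suc l) s (s≤s s≤l) r₁<s y∈ = S.Exchange.not-free y∈ r₁<s c₁<c
      -- A cell violating either condition is a better second cell: farther right, where the row
      -- measure restarts, or lower in the same column.
      (λ {M} {d} r₁<M c<d → search k d (<-≤-trans N<k+c (subst (_≤ k + d) (+-suc k c) (+-monoʳ-≤ k c<d)))
                              (<-trans c₁<c c<d) (suc M) M ≤-refl r₁<M)
      (λ r₁<M M<s → search (suc k) c N<k+c c₁<c l _ (<-≤-trans M<s s≤l) r₁<M)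
      u mf

theorem1p3 : (D₀ : Diagram) → WellFormed D₀ → Northeast D₀ →
    MultiplicityFree D₀ ⇔ (¬ BadPair D₀)
theorem1p3 D₀ wf ne = mk⇔ (λ mf bad → not-free wf bad mf) (free wf)
  where open Heights D₀ ne
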